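{- Let $G$ be a bipartite graph of order $n$. Then $$Mo(G) \leq \alpha_1(1-\alpha_1)(1-2\alpha_1)n^3=\frac{\sqrt{3}}{18}n^3,$$ where $\alpha_1=\frac{1}{2}\left(1-\frac{1}{\sqrt{3}}\right)$.
   Context: All graphs are finite and simple. For a graph $G$ and an edge $uv$ of $G$, $n_G(u,v)$ denotes the number of vertices of $G$ whose distance in $G$ to $u$ is strictly smaller than their distance in $G$ to $v$. The Mostar index of $G$ is $Mo(G)=\sum_{uv\in E(G)}|n_G(u,v)-n_G(v,u)|$. -}

module Defs where

open import Data.Bool.Base using (Bool)
open import Data.Fin.Base as Fin using (Fin; zero; suc; toℕ)
import Data.Fin.Properties as Fin
import Data.Integer.Base as ℤ
import Data.Integer.Properties as ℤ
open import Data.List.Base using (List; []; _∷_; length; filter; map; head; upTo; applyUpTo; allFin; cartesianProduct)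
open import Data.Nat.Base as ℕ using (ℕ; zero; suc; z≤n; s≤s; ∣_-_∣)
import Data.Nat.Induction as ℕ
open import Data.Nat.ListAction using (sum)
import Data.Nat.Properties as ℕ
open import Data.Nat.Solver using () renaming (module +-*-Solver to ℕ-Solver)
open import Data.Product.Base using (Σ-syntax; ∃-syntax; _×_; _,_)
open import Data.Rational.Base as ℚ using (ℚ; 0ℚ; 1ℚ; ½)
import Data.Rational.Properties as ℚ
open import Data.Rational.Solver using () renaming (module +-*-Solver to ℚ-Solver)
open import Data.Rational.Unnormalised.Base as ℚᵘ using (mkℚᵘ)
import Data.Rational.Unnormalised.Properties as ℚᵘ
open import Data.Sum.Base using (inj₁; inj₂)
open import Level using (0ℓ)
open import Relation.Binary.Core using (Rel)
open import Relation.Binary.Definitions using (Decidable; Symmetric)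
import Relation.Binary.Construct.Add.Supremum.Strict as Supremum
open import Relation.Binary.PropositionalEquality
open import Relation.Nullary using (¬_; Dec; yes; no; contradiction)
open import Relation.Nullary.Decidable using (map′; _×-dec_)
open import Relation.Nullary.Construct.Add.Supremum using (_⁺; ⊤⁺; [_])
import Relation.Unary as U

record Graph (n : ℕ) : Set₁ where
  field
    _~_    : Rel (Fin n) 0ℓ
    _~?_   : Decidable _~_
    ~-sym  : Symmetric _~_
    ~-irr  : ∀ {u} → ¬ (u ~ u)

infix 4 _<∞_ _<∞?_

_<∞_ : Rel (ℕ ⁺) 0ℓ
_<∞_ = Supremum._<⁺_ ℕ._<_

_<∞?_ : Decidable _<∞_
_<∞?_ = Supremum.<⁺-dec ℕ._<_ ℕ._<?_

module _ {n : ℕ} (G : Graph n) where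
  open Graph G

  Bipartite : Set
  Bipartite = Σ[ side ∈ (Fin n → Bool) ] (∀ u v → u ~ v → side u ≢ side v)

  infixr 5 _∷_

  data Walk : Fin n → Fin n → ℕ → Set where
    []  : ∀ {u} → Walk u u 0
    _∷_ : ∀ {u v w k} → u ~ v → Walk v w k → Walk u w (suc k)

  walk? : ∀ u v k → Dec (Walk u v k)
  walk? u v zero    = map′ (λ { refl → [] }) (λ { [] → refl }) (u Fin.≟ v)
  walk? u v (suc k) = map′ (λ { (x , e , p) → e ∷ p }) (λ { (e ∷ p) → _ , e , p })
                           (Fin.any? (λ x → (u ~? x) ×-dec walk? x v k))

  -- ⊤⁺ stands for ∞, the distance between different components.
  IsDistance : Fin n → Fin n → ℕ ⁺ → Set
  IsDistance u v [ k ] = Walk u v k × (∀ l → Walk u v l → k ℕ.≤ l)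
  IsDistance u v ⊤⁺    = ∀ l → ¬ Walk u v l

  -- The least length < n of a walk. Vertices joined by a walk are joined by
  -- one with fewer than n edges; see dist-correct.
  dist : Fin n → Fin n → ℕ ⁺
  dist u v = head (filter (walk? u v) (upTo n))

  -- n_G(u,v)
  closer : Fin n → Fin n → ℕ
  closer u v = length (filter (λ w → dist w u <∞? dist w v) (allFin n))

  -- Each edge {u , v} is listed once, with u < v.
  edges : List (Fin n × Fin n)
  edges = filter (λ (u , v) → (u Fin.<? v) ×-dec (u ~? v)) (cartesianProduct (allFin n) (allFin n))

  Mo : ℕ
  Mo = sum (map (λ (u , v) → ∣ closer u v - closer v u ∣) edges)

  vertexAt : ∀ {u v k} → Walk u v k → Fin (suc k) → Fin n
  vertexAt {u} p       zero    = u
  vertexAt     (e ∷ p) (suc i) = vertexAt p i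

  takeW : ∀ {u v k} (p : Walk u v k) i → Walk u (vertexAt p i) (toℕ i)
  takeW p       zero    = []
  takeW (e ∷ p) (suc i) = e ∷ takeW p i

  dropW : ∀ {u v k} (p : Walk u v k) i → Walk (vertexAt p i) v (k ℕ.∸ toℕ i)
  dropW p       zero    = p
  dropW (e ∷ p) (suc i) = dropW p i

  _++W_ : ∀ {u v w k l} → Walk u v k → Walk v w l → Walk u w (k ℕ.+ l)
  []      ++W q = q
  (e ∷ p) ++W q = e ∷ (p ++W q)

  shorten : ∀ {u v k} → n ℕ.≤ k → Walk u v k → ∃[ l ] (l ℕ.< k × Walk u v l)
  shorten {u} {v} {k} n≤k p with Fin.pigeonhole (s≤s n≤k) (vertexAt p)
  ... | i , j , i<j , eq =
    toℕ i ℕ.+ (k ℕ.∸ toℕ j) , lt ,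
    (takeW p i ++W subst (λ x → Walk x v _) (sym eq) (dropW p j))
    where
    lt : toℕ i ℕ.+ (k ℕ.∸ toℕ j) ℕ.< k
    lt = subst (toℕ i ℕ.+ (k ℕ.∸ toℕ j) ℕ.<_)
               (ℕ.m+[n∸m]≡n (ℕ.s≤s⁻¹ (Fin.toℕ<n j)))
               (ℕ.+-monoˡ-< (k ℕ.∸ toℕ j) i<j)

  short : ∀ {u v} k → ℕ.Acc ℕ._<_ k → Walk u v k → ∃[ l ] (l ℕ.< n × l ℕ.≤ k × Walk u v l)
  short k (ℕ.acc rs) p with k ℕ.<? n
  ... | yes k<n = k , k<n , ℕ.≤-refl , p
  ... | no  k≮n with shorten (ℕ.≮⇒≥ k≮n) p
  ...   | l , l<k , q with short l (rs l<k) q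
  ...     | m , m<n , m≤l , r = m , m<n , ℕ.≤-trans m≤l (ℕ.<⇒≤ l<k) , r

  First : (P : ℕ → Set) (f : ℕ → ℕ) → ℕ → ℕ ⁺ → Set
  First P f b [ k ] = ∃[ i ] (k ≡ f i × P k × (∀ j → j ℕ.< b → P (f j) → i ℕ.≤ j))
  First P f b ⊤⁺    = ∀ j → j ℕ.< b → ¬ P (f j)

  first : ∀ {P : ℕ → Set} (P? : U.Decidable P) f b → First P f b (head (filter P? (applyUpTo f b)))
  first P? f zero = λ j ()
  first P? f (suc b) with P? (f 0)
  ... | yes p = 0 , refl , p , λ _ _ _ → z≤n
  ... | no ¬p with head (filter P? (applyUpTo (λ i → f (suc i)) b)) | first P? (λ i → f (suc i)) b
  ...   | [ k ] | i , eq , p , least =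
    suc i , eq , p , λ { zero _ q → contradiction q ¬p ; (suc j) (s≤s j<b) q → s≤s (least j j<b q) }
  ...   | ⊤⁺    | none = λ { zero _ → ¬p ; (suc j) (s≤s j<b) → none j j<b }

  dist-correct : ∀ u v → IsDistance u v (dist u v)
  dist-correct u v with dist u v | first (walk? u v) (λ i → i) n
  ... | [ k ] | .k , refl , p , least = p , λ l q →
    let m , m<n , m≤l , r = short l (ℕ.<-wellFounded l) q
    in ℕ.≤-trans (least m m<n r) m≤l
  ... | ⊤⁺    | none = λ l q →
    let m , m<n , _ , r = short l (ℕ.<-wellFounded l) q
    in none m m<n r

-- Cauchy sequences of rationals; equality of reals is _≃_, not _≡_.
record ℝ : Set where
  constructor mkℝ
  field
    seq    : ℕ → ℚ
    cauchy : ∀ ε → 0ℚ ℚ.< ε → ∃[ N ] (∀ m k → N ℕ.≤ m → N ℕ.≤ k → ℚ.∣ seq m ℚ.- seq k ∣ ℚ.≤ ε)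

open ℝ public

infix 4 _≃_ _≤ℝ_

_≃_ : Rel ℝ 0ℓ
x ≃ y = ∀ ε → 0ℚ ℚ.< ε → ∃[ N ] (∀ k → N ℕ.≤ k → ℚ.∣ seq x k ℚ.- seq y k ∣ ℚ.≤ ε)

_≤ℝ_ : Rel ℝ 0ℓ
x ≤ℝ y = ∀ ε → 0ℚ ℚ.< ε → ∃[ N ] (∀ k → N ℕ.≤ k → seq x k ℚ.≤ seq y k ℚ.+ ε)

_≄0 : ℝ → Set
x ≄0 = ∃[ δ ] (0ℚ ℚ.< δ × ∃[ N ] (∀ k → N ℕ.≤ k → δ ℚ.≤ ℚ.∣ seq x k ∣))

half : ∀ {ε} → 0ℚ ℚ.< ε → 0ℚ ℚ.< ε ℚ.* ½
half {ε} ε>0 = subst (ℚ._< ε ℚ.* ½) (ℚ.*-zeroˡ ½) (ℚ.*-monoˡ-<-pos ½ ε>0)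

half+half : ∀ ε → ε ℚ.* ½ ℚ.+ ε ℚ.* ½ ≡ ε
half+half ε = trans (sym (ℚ.*-distribˡ-+ ε ½ ½)) (ℚ.*-identityʳ ε)

pos*pos : ∀ {p q} → 0ℚ ℚ.< p → 0ℚ ℚ.< q → 0ℚ ℚ.< p ℚ.* q
pos*pos {p} {q} p>0 q>0 =
  ℚ.positive⁻¹ (p ℚ.* q) {{ℚ.pos*pos⇒pos p {{ℚ.positive p>0}} q {{ℚ.positive q>0}}}}

*-mono : ∀ {p q r s} → 0ℚ ℚ.≤ p → 0ℚ ℚ.≤ s → p ℚ.≤ q → r ℚ.≤ s → p ℚ.* r ℚ.≤ q ℚ.* s
*-mono {p} {q} {r} {s} 0≤p 0≤s p≤q r≤s = ℚ.≤-trans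
  (ℚ.*-monoˡ-≤-nonNeg p {{ℚ.nonNegative 0≤p}} r≤s)
  (ℚ.*-monoʳ-≤-nonNeg s {{ℚ.nonNegative 0≤s}} p≤q)

∣p-q∣≡∣q-p∣ : ∀ p q → ℚ.∣ p ℚ.- q ∣ ≡ ℚ.∣ q ℚ.- p ∣
∣p-q∣≡∣q-p∣ p q = trans (sym (ℚ.∣-p∣≡∣p∣ (p ℚ.- q))) (cong ℚ.∣_∣ eq)
  where
  open ℚ-Solver
  eq : ℚ.- (p ℚ.- q) ≡ q ℚ.- p
  eq = solve 2 (λ p q → :- (p :- q) := q :- p) refl p q

p-q≤r : ∀ {p q r} → p ℚ.≤ q ℚ.+ r → p ℚ.- q ℚ.≤ r
p-q≤r {p} {q} {r} h = subst (p ℚ.- q ℚ.≤_) eq (ℚ.+-monoˡ-≤ (ℚ.- q) h)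
  where
  open ℚ-Solver
  eq : q ℚ.+ r ℚ.- q ≡ r
  eq = solve 2 (λ q r → q :+ r :- q := r) refl q r

∣p∣≤ : ∀ {p r} → p ℚ.≤ r → ℚ.- p ℚ.≤ r → ℚ.∣ p ∣ ℚ.≤ r
∣p∣≤ {p} {r} p≤r -p≤r with ℚ.∣p∣≡p∨∣p∣≡-p p
... | inj₁ eq = subst (ℚ._≤ r) (sym eq) p≤r
... | inj₂ eq = subst (ℚ._≤ r) (sym eq) -p≤r

∣p-q∣≤ : ∀ {p q r} → p ℚ.≤ q ℚ.+ r → q ℚ.≤ p ℚ.+ r → ℚ.∣ p ℚ.- q ∣ ℚ.≤ r
∣p-q∣≤ {p} {q} {r} h₁ h₂ = ∣p∣≤ (p-q≤r h₁) (subst (ℚ._≤ r) eq (p-q≤r h₂))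
  where
  open ℚ-Solver
  eq : q ℚ.- p ≡ ℚ.- (p ℚ.- q)
  eq = solve 2 (λ p q → q :- p := :- (p :- q)) refl p q

recip : ∀ {p} → 0ℚ ℚ.< p → ∃[ q ] (0ℚ ℚ.< q × q ℚ.* p ≡ 1ℚ)
recip {p} p>0 = (ℚ.1/ p) {{nz}} , ℚ.positive⁻¹ _ {{ℚ.1/pos⇒pos p {{ℚ.positive p>0}}}} , ℚ.*-inverseˡ p {{nz}}
  where nz = ℚ.>-nonZero p>0

bounded : ∀ x → ∃[ B ] (0ℚ ℚ.< B × ∃[ N ] (∀ k → N ℕ.≤ k → ℚ.∣ seq x k ∣ ℚ.≤ B))
bounded x with cauchy x 1ℚ (ℚ.positive⁻¹ 1ℚ)
... | N , close = B , B>0 , N , bound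
  where
  B = 1ℚ ℚ.+ ℚ.∣ seq x N ∣
  B>0 : 0ℚ ℚ.< B
  B>0 = ℚ.+-mono-<-≤ (ℚ.positive⁻¹ 1ℚ) (ℚ.0≤∣p∣ (seq x N))
  open ℚ-Solver
  bound : ∀ k → N ℕ.≤ k → ℚ.∣ seq x k ∣ ℚ.≤ B
  bound k N≤k = ℚ.≤-trans
    (subst (λ z → ℚ.∣ z ∣ ℚ.≤ ℚ.∣ seq x k ℚ.- seq x N ∣ ℚ.+ ℚ.∣ seq x N ∣)
           (solve 2 (λ a b → a :- b :+ b := a) refl (seq x k) (seq x N))
           (ℚ.∣p+q∣≤∣p∣+∣q∣ (seq x k ℚ.- seq x N) (seq x N)))
    (ℚ.+-monoˡ-≤ ℚ.∣ seq x N ∣ (close k N N≤k ℕ.≤-refl))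

fromℚ : ℚ → ℝ
fromℚ q .seq _ = q
fromℚ q .cauchy ε ε>0 = 0 , λ _ _ _ _ →
  subst (λ z → ℚ.∣ z ∣ ℚ.≤ ε) (sym (ℚ.+-inverseʳ q)) (ℚ.<⇒≤ ε>0)

fromℕ : ℕ → ℝ
fromℕ k = fromℚ (ℤ.+ k ℚ./ 1)

infixl 6 _+ℝ_ _-ℝ_
infixl 7 _*ℝ_
infix  8 -ℝ_

_+ℝ_ : ℝ → ℝ → ℝ
(x +ℝ y) .seq k = seq x k ℚ.+ seq y k
(x +ℝ y) .cauchy ε ε>0 with cauchy x (ε ℚ.* ½) (half ε>0) | cauchy y (ε ℚ.* ½) (half ε>0)
... | N , p | M , q = N ℕ.⊔ M , λ m k N≤m N≤k → begin
  ℚ.∣ seq x m ℚ.+ seq y m ℚ.- (seq x k ℚ.+ seq y k) ∣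
    ≡⟨ cong ℚ.∣_∣ (solve 4 (λ a b c d → a :+ b :- (c :+ d) := (a :- c) :+ (b :- d)) refl
                           (seq x m) (seq y m) (seq x k) (seq y k)) ⟩
  ℚ.∣ (seq x m ℚ.- seq x k) ℚ.+ (seq y m ℚ.- seq y k) ∣
    ≤⟨ ℚ.∣p+q∣≤∣p∣+∣q∣ (seq x m ℚ.- seq x k) (seq y m ℚ.- seq y k) ⟩
  ℚ.∣ seq x m ℚ.- seq x k ∣ ℚ.+ ℚ.∣ seq y m ℚ.- seq y k ∣
    ≤⟨ ℚ.+-mono-≤ (p m k (ℕ.m⊔n≤o⇒m≤o N M N≤m) (ℕ.m⊔n≤o⇒m≤o N M N≤k))
                  (q m k (ℕ.m⊔n≤o⇒n≤o N M N≤m) (ℕ.m⊔n≤o⇒n≤o N M N≤k)) ⟩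
  ε ℚ.* ½ ℚ.+ ε ℚ.* ½
    ≡⟨ half+half ε ⟩
  ε ∎
  where open ℚ.≤-Reasoning; open ℚ-Solver

-ℝ_ : ℝ → ℝ
(-ℝ x) .seq k = ℚ.- seq x k
(-ℝ x) .cauchy ε ε>0 with cauchy x ε ε>0
... | N , p = N , λ m k N≤m N≤k →
  subst (λ z → ℚ.∣ z ∣ ℚ.≤ ε)
        (solve 2 (λ a b → b :- a := (:- a) :- (:- b)) refl (seq x m) (seq x k))
        (p k m N≤k N≤m)
  where open ℚ-Solver

_-ℝ_ : ℝ → ℝ → ℝ
x -ℝ y = x +ℝ (-ℝ y)

*-close : ∀ {a b c d e B B⁻¹ C C⁻¹} → 0ℚ ℚ.< e → 0ℚ ℚ.< B⁻¹ → 0ℚ ℚ.< C →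
          B⁻¹ ℚ.* B ≡ 1ℚ → C⁻¹ ℚ.* C ≡ 1ℚ → ℚ.∣ a ∣ ℚ.≤ B → ℚ.∣ d ∣ ℚ.≤ C →
          ℚ.∣ a ℚ.- c ∣ ℚ.≤ e ℚ.* C⁻¹ → ℚ.∣ b ℚ.- d ∣ ℚ.≤ e ℚ.* B⁻¹ →
          ℚ.∣ a ℚ.* b ℚ.- c ℚ.* d ∣ ℚ.≤ e ℚ.+ e
*-close {a} {b} {c} {d} {e} {B} {B⁻¹} {C} {C⁻¹} e>0 B⁻¹>0 C>0 B⁻¹B≡1 C⁻¹C≡1 a≤B d≤C ac bd = begin
  ℚ.∣ a ℚ.* b ℚ.- c ℚ.* d ∣
    ≡⟨ cong ℚ.∣_∣ (solve 4 (λ a b c d → a :* b :- c :* d := (a :- c) :* d :+ a :* (b :- d)) refl a b c d) ⟩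
  ℚ.∣ (a ℚ.- c) ℚ.* d ℚ.+ a ℚ.* (b ℚ.- d) ∣
    ≤⟨ ℚ.∣p+q∣≤∣p∣+∣q∣ ((a ℚ.- c) ℚ.* d) (a ℚ.* (b ℚ.- d)) ⟩
  ℚ.∣ (a ℚ.- c) ℚ.* d ∣ ℚ.+ ℚ.∣ a ℚ.* (b ℚ.- d) ∣
    ≡⟨ cong₂ ℚ._+_ (ℚ.∣p*q∣≡∣p∣*∣q∣ (a ℚ.- c) d) (ℚ.∣p*q∣≡∣p∣*∣q∣ a (b ℚ.- d)) ⟩
  ℚ.∣ a ℚ.- c ∣ ℚ.* ℚ.∣ d ∣ ℚ.+ ℚ.∣ a ∣ ℚ.* ℚ.∣ b ℚ.- d ∣
    ≤⟨ ℚ.+-mono-≤ (*-mono (ℚ.0≤∣p∣ (a ℚ.- c)) (ℚ.<⇒≤ C>0) ac d≤C)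
                  (*-mono (ℚ.0≤∣p∣ a) (ℚ.<⇒≤ (pos*pos e>0 B⁻¹>0)) a≤B bd) ⟩
  e ℚ.* C⁻¹ ℚ.* C ℚ.+ B ℚ.* (e ℚ.* B⁻¹)
    ≡⟨ cong₂ ℚ._+_ (ℚ.*-assoc e C⁻¹ C) (trans (ℚ.*-comm B (e ℚ.* B⁻¹)) (ℚ.*-assoc e B⁻¹ B)) ⟩
  e ℚ.* (C⁻¹ ℚ.* C) ℚ.+ e ℚ.* (B⁻¹ ℚ.* B)
    ≡⟨ cong₂ (λ s t → e ℚ.* s ℚ.+ e ℚ.* t) C⁻¹C≡1 B⁻¹B≡1 ⟩
  e ℚ.* 1ℚ ℚ.+ e ℚ.* 1ℚ
    ≡⟨ cong₂ ℚ._+_ (ℚ.*-identityʳ e) (ℚ.*-identityʳ e) ⟩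
  e ℚ.+ e ∎
  where open ℚ.≤-Reasoning; open ℚ-Solver

_*ℝ_ : ℝ → ℝ → ℝ
(x *ℝ y) .seq k = seq x k ℚ.* seq y k
(x *ℝ y) .cauchy ε ε>0 =
  let B , B>0 , N₁ , x≤B = bounded x
      C , C>0 , N₂ , y≤C = bounded y
      B⁻¹ , B⁻¹>0 , B⁻¹B≡1 = recip B>0
      C⁻¹ , C⁻¹>0 , C⁻¹C≡1 = recip C>0
      N₃ , p = cauchy x (ε ℚ.* ½ ℚ.* C⁻¹) (pos*pos (half ε>0) C⁻¹>0)
      N₄ , q = cauchy y (ε ℚ.* ½ ℚ.* B⁻¹) (pos*pos (half ε>0) B⁻¹>0)
  in (N₁ ℕ.⊔ N₂) ℕ.⊔ (N₃ ℕ.⊔ N₄) , λ m k N≤m N≤k →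
  let N₁₂≤m = ℕ.m⊔n≤o⇒m≤o (N₁ ℕ.⊔ N₂) (N₃ ℕ.⊔ N₄) N≤m
      N₁₂≤k = ℕ.m⊔n≤o⇒m≤o (N₁ ℕ.⊔ N₂) (N₃ ℕ.⊔ N₄) N≤k
      N₃₄≤m = ℕ.m⊔n≤o⇒n≤o (N₁ ℕ.⊔ N₂) (N₃ ℕ.⊔ N₄) N≤m
      N₃₄≤k = ℕ.m⊔n≤o⇒n≤o (N₁ ℕ.⊔ N₂) (N₃ ℕ.⊔ N₄) N≤k
  in subst (ℚ.∣ seq x m ℚ.* seq y m ℚ.- seq x k ℚ.* seq y k ∣ ℚ.≤_) (half+half ε)
       (*-close {seq x m} {seq y m} {seq x k} {seq y k} {ε ℚ.* ½} {B} {B⁻¹} {C} {C⁻¹}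
          (half ε>0) B⁻¹>0 C>0 B⁻¹B≡1 C⁻¹C≡1
          (x≤B m (ℕ.m⊔n≤o⇒m≤o N₁ N₂ N₁₂≤m))
          (y≤C k (ℕ.m⊔n≤o⇒n≤o N₁ N₂ N₁₂≤k))
          (p m k (ℕ.m⊔n≤o⇒m≤o N₃ N₄ N₃₄≤m) (ℕ.m⊔n≤o⇒m≤o N₃ N₄ N₃₄≤k))
          (q m k (ℕ.m⊔n≤o⇒n≤o N₃ N₄ N₃₄≤m) (ℕ.m⊔n≤o⇒n≤o N₃ N₄ N₃₄≤k)))

-- The reciprocal on ℚ, with the junk value 0 at 0.
inv : ℚ → ℚ
inv p with p ℚ.≟ 0ℚ
... | yes _  = 0ℚ
... | no p≢0 = (ℚ.1/ p) {{ℚ.≢-nonZero p≢0}}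

inv-inverse : ∀ {p} → p ≢ 0ℚ → p ℚ.* inv p ≡ 1ℚ
inv-inverse {p} p≢0 with p ℚ.≟ 0ℚ
... | yes p≡0 = contradiction p≡0 p≢0
... | no p≢0′ = ℚ.*-inverseʳ p {{ℚ.≢-nonZero p≢0′}}

≄0⇒≢0 : ∀ {δ p} → 0ℚ ℚ.< δ → δ ℚ.≤ ℚ.∣ p ∣ → p ≢ 0ℚ
≄0⇒≢0 δ>0 δ≤ refl = ℚ.<-irrefl refl (ℚ.<-≤-trans δ>0 δ≤)

∣inv∣≤ : ∀ {δ δ⁻¹ p} → 0ℚ ℚ.< δ → 0ℚ ℚ.< δ⁻¹ → δ⁻¹ ℚ.* δ ≡ 1ℚ → δ ℚ.≤ ℚ.∣ p ∣ → ℚ.∣ inv p ∣ ℚ.≤ δ⁻¹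
∣inv∣≤ {δ} {δ⁻¹} {p} δ>0 δ⁻¹>0 eq δ≤ = begin
  ℚ.∣ inv p ∣                              ≡⟨ sym (ℚ.*-identityˡ _) ⟩
  1ℚ ℚ.* ℚ.∣ inv p ∣                       ≡⟨ cong (ℚ._* ℚ.∣ inv p ∣) (sym eq) ⟩
  δ⁻¹ ℚ.* δ ℚ.* ℚ.∣ inv p ∣                ≤⟨ ℚ.*-monoʳ-≤-nonNeg ℚ.∣ inv p ∣ {{ℚ.∣-∣-nonNeg (inv p)}}
                                               (ℚ.*-monoˡ-≤-nonNeg δ⁻¹ {{ℚ.nonNegative (ℚ.<⇒≤ δ⁻¹>0)}} δ≤) ⟩
  δ⁻¹ ℚ.* ℚ.∣ p ∣ ℚ.* ℚ.∣ inv p ∣          ≡⟨ ℚ.*-assoc δ⁻¹ ℚ.∣ p ∣ ℚ.∣ inv p ∣ ⟩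
  δ⁻¹ ℚ.* (ℚ.∣ p ∣ ℚ.* ℚ.∣ inv p ∣)        ≡⟨ cong (δ⁻¹ ℚ.*_) (sym (ℚ.∣p*q∣≡∣p∣*∣q∣ p (inv p))) ⟩
  δ⁻¹ ℚ.* ℚ.∣ p ℚ.* inv p ∣                ≡⟨ cong (λ z → δ⁻¹ ℚ.* ℚ.∣ z ∣) (inv-inverse (≄0⇒≢0 δ>0 δ≤)) ⟩
  δ⁻¹ ℚ.* 1ℚ                               ≡⟨ ℚ.*-identityʳ δ⁻¹ ⟩
  δ⁻¹                                      ∎
  where open ℚ.≤-Reasoning

inv-close : ∀ {a b δ δ⁻¹ ε} → 0ℚ ℚ.< δ → 0ℚ ℚ.< δ⁻¹ → δ⁻¹ ℚ.* δ ≡ 1ℚ →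
            δ ℚ.≤ ℚ.∣ a ∣ → δ ℚ.≤ ℚ.∣ b ∣ → ℚ.∣ b ℚ.- a ∣ ℚ.≤ ε ℚ.* (δ ℚ.* δ) →
            ℚ.∣ inv a ℚ.- inv b ∣ ℚ.≤ ε
inv-close {a} {b} {δ} {δ⁻¹} {ε} δ>0 δ⁻¹>0 eq δ≤a δ≤b ba = begin
  ℚ.∣ inv a ℚ.- inv b ∣
    ≡⟨ cong ℚ.∣_∣ (cong₂ ℚ._-_ (expand a b (≄0⇒≢0 δ>0 δ≤b)) (expand b a (≄0⇒≢0 δ>0 δ≤a))) ⟩
  ℚ.∣ inv a ℚ.* (b ℚ.* inv b) ℚ.- inv b ℚ.* (a ℚ.* inv a) ∣
    ≡⟨ cong ℚ.∣_∣ (factor a b (inv a) (inv b)) ⟩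
  ℚ.∣ (b ℚ.- a) ℚ.* (inv a ℚ.* inv b) ∣
    ≡⟨ trans (ℚ.∣p*q∣≡∣p∣*∣q∣ (b ℚ.- a) (inv a ℚ.* inv b)) (cong (ℚ.∣ b ℚ.- a ∣ ℚ.*_) (ℚ.∣p*q∣≡∣p∣*∣q∣ (inv a) (inv b))) ⟩
  ℚ.∣ b ℚ.- a ∣ ℚ.* (ℚ.∣ inv a ∣ ℚ.* ℚ.∣ inv b ∣)
    ≤⟨ *-mono (ℚ.0≤∣p∣ (b ℚ.- a)) (ℚ.<⇒≤ (pos*pos δ⁻¹>0 δ⁻¹>0)) ba
              (*-mono (ℚ.0≤∣p∣ (inv a)) (ℚ.<⇒≤ δ⁻¹>0)
                      (∣inv∣≤ {p = a} δ>0 δ⁻¹>0 eq δ≤a) (∣inv∣≤ {p = b} δ>0 δ⁻¹>0 eq δ≤b)) ⟩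
  ε ℚ.* (δ ℚ.* δ) ℚ.* (δ⁻¹ ℚ.* δ⁻¹)
    ≡⟨ regroup ε δ δ⁻¹ ⟩
  ε ℚ.* ((δ⁻¹ ℚ.* δ) ℚ.* (δ⁻¹ ℚ.* δ))
    ≡⟨ cong (λ z → ε ℚ.* (z ℚ.* z)) eq ⟩
  ε ℚ.* (1ℚ ℚ.* 1ℚ)
    ≡⟨ ℚ.*-identityʳ ε ⟩
  ε ∎
  where
  open ℚ.≤-Reasoning
  open ℚ-Solver
  expand : ∀ p q → q ≢ 0ℚ → inv p ≡ inv p ℚ.* (q ℚ.* inv q)
  expand p q q≢0 = trans (sym (ℚ.*-identityʳ (inv p))) (cong (inv p ℚ.*_) (sym (inv-inverse q≢0)))
  factor : ∀ a b c d → c ℚ.* (b ℚ.* d) ℚ.- d ℚ.* (a ℚ.* c) ≡ (b ℚ.- a) ℚ.* (c ℚ.* d)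
  factor = solve 4 (λ a b c d → c :* (b :* d) :- d :* (a :* c) := (b :- a) :* (c :* d)) refl
  regroup : ∀ e d f → e ℚ.* (d ℚ.* d) ℚ.* (f ℚ.* f) ≡ e ℚ.* ((f ℚ.* d) ℚ.* (f ℚ.* d))
  regroup = solve 3 (λ e d f → e :* (d :* d) :* (f :* f) := e :* ((f :* d) :* (f :* d))) refl

1/ℝ : (x : ℝ) → x ≄0 → ℝ
1/ℝ x x≄0 .seq k = inv (seq x k)
1/ℝ x (δ , δ>0 , N₁ , δ≤x) .cauchy ε ε>0 =
  let N₂ , p = cauchy x (ε ℚ.* (δ ℚ.* δ)) (pos*pos ε>0 (pos*pos δ>0 δ>0))
      δ⁻¹ , δ⁻¹>0 , eq = recip δ>0
  in N₁ ℕ.⊔ N₂ , λ m k N≤m N≤k →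
       inv-close {seq x m} {seq x k} {δ} {δ⁻¹} {ε} δ>0 δ⁻¹>0 eq
         (δ≤x m (ℕ.m⊔n≤o⇒m≤o N₁ N₂ N≤m))
         (δ≤x k (ℕ.m⊔n≤o⇒m≤o N₁ N₂ N≤k))
         (p k m (ℕ.m⊔n≤o⇒n≤o N₁ N₂ N≤k) (ℕ.m⊔n≤o⇒n≤o N₁ N₂ N≤m))

1/ℝ-inverse : ∀ x (x≄0 : x ≄0) → x *ℝ 1/ℝ x x≄0 ≃ fromℕ 1
1/ℝ-inverse x (δ , δ>0 , N , δ≤x) ε ε>0 = N , λ k N≤k →
  subst (λ z → ℚ.∣ z ℚ.- 1ℚ ∣ ℚ.≤ ε) (sym (inv-inverse (≄0⇒≢0 δ>0 (δ≤x k N≤k)))) (ℚ.<⇒≤ ε>0)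

isqrt : ℕ → ℕ
isqrt zero    = 0
isqrt (suc a) with suc (isqrt a) ℕ.* suc (isqrt a) ℕ.≤? suc a
... | yes _ = suc (isqrt a)
... | no  _ = isqrt a

isqrt-lower : ∀ a → isqrt a ℕ.* isqrt a ℕ.≤ a
isqrt-lower zero = z≤n
isqrt-lower (suc a) with suc (isqrt a) ℕ.* suc (isqrt a) ℕ.≤? suc a
... | yes h = h
... | no  _ = ℕ.m≤n⇒m≤1+n (isqrt-lower a)

sq-mono-< : ∀ {a b} → a ℕ.< b → a ℕ.* a ℕ.< b ℕ.* b
sq-mono-< {a} {b} a<b = ℕ.*-mono-< {a} {b} {a} {b} a<b a<b

isqrt-upper : ∀ a → a ℕ.< suc (isqrt a) ℕ.* suc (isqrt a)
isqrt-upper zero = s≤s z≤n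
isqrt-upper (suc a) with suc (isqrt a) ℕ.* suc (isqrt a) ℕ.≤? suc a
... | yes h = ℕ.≤-<-trans (isqrt-upper a) (sq-mono-< (ℕ.n<1+n (suc (isqrt a))))
... | no ¬h = ℕ.≰⇒> ¬h

sq-cancel-< : ∀ {a b} → a ℕ.* a ℕ.< b ℕ.* b → a ℕ.< b
sq-cancel-< {a} {b} h with a ℕ.<? b
... | yes a<b = a<b
... | no  a≮b = contradiction (ℕ.*-mono-≤ (ℕ.≮⇒≥ a≮b) (ℕ.≮⇒≥ a≮b)) (ℕ.<⇒≱ h)

-- sqrtNum a k / (k + 1) is the largest fraction with denominator k + 1 and square ≤ a.
sqrtNum : ℕ → ℕ → ℕ
sqrtNum a k = isqrt (a ℕ.* (suc k ℕ.* suc k))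

sqrtNum-cross : ∀ a m k → sqrtNum a m ℕ.* suc k ℕ.≤ suc (sqrtNum a k) ℕ.* suc m
sqrtNum-cross a m k = ℕ.<⇒≤ (sq-cancel-< (begin-strict
  r ℕ.* K ℕ.* (r ℕ.* K)      ≡⟨ solve 2 (λ r K → r :* K :* (r :* K) := r :* r :* (K :* K)) refl r K ⟩
  r ℕ.* r ℕ.* (K ℕ.* K)      ≤⟨ ℕ.*-monoˡ-≤ (K ℕ.* K) (isqrt-lower (a ℕ.* (M ℕ.* M))) ⟩
  a ℕ.* (M ℕ.* M) ℕ.* (K ℕ.* K)  ≡⟨ solve 3 (λ a M K → a :* (M :* M) :* (K :* K) := a :* (K :* K) :* (M :* M)) refl a M K ⟩
  a ℕ.* (K ℕ.* K) ℕ.* (M ℕ.* M)  <⟨ ℕ.*-monoˡ-< (M ℕ.* M) (isqrt-upper (a ℕ.* (K ℕ.* K))) ⟩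
  s ℕ.* s ℕ.* (M ℕ.* M)      ≡⟨ solve 2 (λ s M → s :* s :* (M :* M) := s :* M :* (s :* M)) refl s M ⟩
  s ℕ.* M ℕ.* (s ℕ.* M)      ∎))
  where
  open ℕ.≤-Reasoning
  open ℕ-Solver
  M = suc m
  K = suc k
  r = sqrtNum a m
  s = suc (sqrtNum a k)

toℚᵘ-/ : ∀ a d → ℚ.toℚᵘ (ℤ.+ a ℚ./ suc d) ℚᵘ.≃ mkℚᵘ (ℤ.+ a) d
toℚᵘ-/ a d = ℚ.toℚᵘ-fromℚᵘ (mkℚᵘ (ℤ.+ a) d)

/-mono-≤ : ∀ {a b c d} → a ℕ.* suc d ℕ.≤ c ℕ.* suc b → ℤ.+ a ℚ./ suc b ℚ.≤ ℤ.+ c ℚ./ suc d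
/-mono-≤ {a} {b} {c} {d} h = ℚ.toℚᵘ-cancel-≤
  (ℚᵘ.≤-respˡ-≃ (ℚᵘ.≃-sym (toℚᵘ-/ a b)) (ℚᵘ.≤-respʳ-≃ (ℚᵘ.≃-sym (toℚᵘ-/ c d))
    (ℚᵘ.*≤* (subst₂ ℤ._≤_ (ℤ.pos-* a (suc d)) (ℤ.pos-* c (suc b)) (ℤ.+≤+ h)))))

/-suc : ∀ a d → ℤ.+ suc a ℚ./ suc d ≡ ℤ.+ a ℚ./ suc d ℚ.+ ℤ.+ 1 ℚ./ suc d
/-suc a d = ℚ.toℚᵘ-injective (ℚᵘ.≃-trans (toℚᵘ-/ (suc a) d) (ℚᵘ.≃-sym (ℚᵘ.≃-trans
  (ℚ.toℚᵘ-homo-+ (ℤ.+ a ℚ./ suc d) (ℤ.+ 1 ℚ./ suc d))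
  (ℚᵘ.≃-trans (ℚᵘ.+-cong (toℚᵘ-/ a d) (toℚᵘ-/ 1 d)) (ℚᵘ.*≡* eq)))))
  where
  open ≡-Reasoning
  D = ℤ.+ suc d
  eq : (ℤ.+ a ℤ.* D ℤ.+ ℤ.+ 1 ℤ.* D) ℤ.* D ≡ ℤ.+ suc a ℤ.* (D ℤ.* D)
  eq = begin
    (ℤ.+ a ℤ.* D ℤ.+ ℤ.+ 1 ℤ.* D) ℤ.* D  ≡⟨ cong (ℤ._* D) (sym (ℤ.*-distribʳ-+ D (ℤ.+ a) (ℤ.+ 1))) ⟩
    ℤ.+ (a ℕ.+ 1) ℤ.* D ℤ.* D            ≡⟨ cong (λ z → ℤ.+ z ℤ.* D ℤ.* D) (ℕ.+-comm a 1) ⟩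
    ℤ.+ suc a ℤ.* D ℤ.* D                ≡⟨ ℤ.*-assoc (ℤ.+ suc a) D D ⟩
    ℤ.+ suc a ℤ.* (D ℤ.* D)              ∎

archimedean : ∀ ε → 0ℚ ℚ.< ε → ∃[ N ] (∀ k → N ℕ.≤ k → ℤ.+ 1 ℚ./ suc k ℚ.≤ ε)
archimedean ε@(ℚ.mkℚ (ℤ.+ suc p) d c) ε>0 = d , λ k d≤k →
  subst (ℤ.+ 1 ℚ./ suc k ℚ.≤_) (ℚ.fromℚᵘ-toℚᵘ ε)
    (/-mono-≤ {1} {k} {suc p} {d} (ℕ.*-mono-≤ {1} {suc p} (s≤s z≤n) (s≤s d≤k)))
archimedean (ℚ.mkℚ (ℤ.+ 0) d c) ε>0 with ℚ.positive ε>0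
... | ()
archimedean (ℚ.mkℚ (ℤ.-[1+ p ]) d c) ε>0 with ℚ.positive ε>0
... | ()

√ : ℕ → ℝ
√ a .seq k = ℤ.+ sqrtNum a k ℚ./ suc k
√ a .cauchy ε ε>0 with archimedean ε ε>0
... | N , small = N , λ m k N≤m N≤k → ∣p-q∣≤ (close m k N≤k) (close k m N≤m)
  where
  close : ∀ m k → N ℕ.≤ k → √ a .seq m ℚ.≤ √ a .seq k ℚ.+ ε
  close m k N≤k = ℚ.≤-trans (/-mono-≤ {sqrtNum a m} {m} {suc (sqrtNum a k)} {k} (sqrtNum-cross a m k))
    (subst (ℚ._≤ √ a .seq k ℚ.+ ε) (sym (/-suc (sqrtNum a k) k)) (ℚ.+-monoʳ-≤ (ℤ.+ sqrtNum a k ℚ./ suc k) (small k N≤k)))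

√≄0 : ∀ a → √ (suc a) ≄0
√≄0 a = 1ℚ , ℚ.positive⁻¹ 1ℚ , 0 , λ k _ → ℚ.≤-trans (1≤ k) (ℚ.≤-reflexive (sym (ℚ.0≤p⇒∣p∣≡p (ℚ.≤-trans (ℚ.nonNegative⁻¹ 1ℚ) (1≤ k)))))
  where
  1≤ : ∀ k → 1ℚ ℚ.≤ √ (suc a) .seq k
  1≤ k = /-mono-≤ {1} {0} {r} {k} (subst₂ ℕ._≤_ (sym (ℕ.*-identityˡ (suc k))) (sym (ℕ.*-identityʳ r))
    (ℕ.s≤s⁻¹ (sq-cancel-< {suc k} {suc r} (ℕ.≤-<-trans
      (ℕ.m≤m+n (suc k ℕ.* suc k) (a ℕ.* (suc k ℕ.* suc k)))
      (isqrt-upper (suc a ℕ.* (suc k ℕ.* suc k)))))))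
    where r = sqrtNum (suc a) k

/-sq : ∀ a d → (ℤ.+ a ℚ./ suc d) ℚ.* (ℤ.+ a ℚ./ suc d) ≡ ℤ.+ (a ℕ.* a) ℚ./ (suc d ℕ.* suc d)
/-sq a d = ℚ.toℚᵘ-injective (ℚᵘ.≃-trans
  (ℚ.toℚᵘ-homo-* (ℤ.+ a ℚ./ suc d) (ℤ.+ a ℚ./ suc d))
  (ℚᵘ.≃-trans (ℚᵘ.*-cong (toℚᵘ-/ a d) (toℚᵘ-/ a d))
    (ℚᵘ.≃-trans (ℚᵘ.*≡* (cong (ℤ._* ℤ.+ (suc d ℕ.* suc d)) (sym (ℤ.pos-* a a))))
                (ℚᵘ.≃-sym (toℚᵘ-/ (a ℕ.* a) (d ℕ.+ d ℕ.* suc d))))))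

√-nonNegative : ∀ a → fromℕ 0 ≤ℝ √ a
√-nonNegative a ε ε>0 = 0 , λ k _ → ℚ.≤-trans
  (/-mono-≤ {0} {0} {sqrtNum a k} {k} z≤n)
  (subst (ℚ._≤ √ a .seq k ℚ.+ ε) (ℚ.+-identityʳ (√ a .seq k)) (ℚ.+-monoʳ-≤ (√ a .seq k) (ℚ.<⇒≤ ε>0)))

√-square : ∀ a → √ a *ℝ √ a ≃ fromℕ a
√-square a ε ε>0 =
  let B , B>0 , N₁ , s≤B = bounded (√ a)
      c>0 = ℚ.+-mono-<-≤ (ℚ.+-mono-< B>0 B>0) (ℚ.nonNegative⁻¹ 1ℚ)
      c⁻¹ , c⁻¹>0 , eq = recip c>0
      N₂ , small = archimedean (ε ℚ.* c⁻¹) (pos*pos ε>0 c⁻¹>0)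
  in N₁ ℕ.⊔ N₂ , λ k N≤k →
     ∣p-q∣≤ (lower k) (upper k B c⁻¹ B>0 eq (s≤B k (ℕ.m⊔n≤o⇒m≤o N₁ N₂ N≤k)) (small k (ℕ.m⊔n≤o⇒n≤o N₁ N₂ N≤k)))
  where
  open ℚ.≤-Reasoning
  A = ℤ.+ a ℚ./ 1
  s : ℕ → ℚ
  s k = ℤ.+ sqrtNum a k ℚ./ suc k
  u : ℕ → ℚ
  u k = ℤ.+ 1 ℚ./ suc k

  lower : ∀ k → s k ℚ.* s k ℚ.≤ A ℚ.+ ε
  lower k = begin
    s k ℚ.* s k                     ≡⟨ /-sq r k ⟩
    ℤ.+ (r ℕ.* r) ℚ./ (suc k ℕ.* suc k)
      ≤⟨ /-mono-≤ {r ℕ.* r} {k ℕ.+ k ℕ.* suc k} {a} {0}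
           (subst (ℕ._≤ a ℕ.* (suc k ℕ.* suc k)) (sym (ℕ.*-identityʳ (r ℕ.* r))) (isqrt-lower (a ℕ.* (suc k ℕ.* suc k)))) ⟩
    A                               ≡⟨ sym (ℚ.+-identityʳ A) ⟩
    A ℚ.+ 0ℚ                        ≤⟨ ℚ.+-monoʳ-≤ A (ℚ.<⇒≤ ε>0) ⟩
    A ℚ.+ ε                         ∎
    where r = sqrtNum a k

  expand : ∀ s u → (s ℚ.+ u) ℚ.* (s ℚ.+ u) ≡ s ℚ.* s ℚ.+ u ℚ.* (s ℚ.+ s ℚ.+ u)
  expand = solve 2 (λ s u → (s :+ u) :* (s :+ u) := s :* s :+ u :* (s :+ s :+ u)) refl
    where open ℚ-Solver

  upper : ∀ k B c⁻¹ → 0ℚ ℚ.< B → c⁻¹ ℚ.* (B ℚ.+ B ℚ.+ 1ℚ) ≡ 1ℚ → ℚ.∣ s k ∣ ℚ.≤ B → u k ℚ.≤ ε ℚ.* c⁻¹ →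
          A ℚ.≤ s k ℚ.* s k ℚ.+ ε
  upper k B c⁻¹ B>0 eq s≤B u≤ = begin
    A ≤⟨ /-mono-≤ {a} {0} {suc r ℕ.* suc r} {k ℕ.+ k ℕ.* suc k}
           (subst (a ℕ.* (suc k ℕ.* suc k) ℕ.≤_) (sym (ℕ.*-identityʳ (suc r ℕ.* suc r))) (ℕ.<⇒≤ (isqrt-upper (a ℕ.* (suc k ℕ.* suc k))))) ⟩
    ℤ.+ (suc r ℕ.* suc r) ℚ./ (suc k ℕ.* suc k)       ≡⟨ sym (/-sq (suc r) k) ⟩
    (ℤ.+ suc r ℚ./ suc k) ℚ.* (ℤ.+ suc r ℚ./ suc k)   ≡⟨ cong (λ z → z ℚ.* z) (/-suc r k) ⟩
    (s k ℚ.+ u k) ℚ.* (s k ℚ.+ u k)                   ≡⟨ expand (s k) (u k) ⟩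
    s k ℚ.* s k ℚ.+ u k ℚ.* (s k ℚ.+ s k ℚ.+ u k)
      ≤⟨ ℚ.+-monoʳ-≤ (s k ℚ.* s k) (*-mono 0≤u 0≤c u≤ (ℚ.+-mono-≤ (ℚ.+-mono-≤ s≤ s≤) u≤1)) ⟩
    s k ℚ.* s k ℚ.+ ε ℚ.* c⁻¹ ℚ.* (B ℚ.+ B ℚ.+ 1ℚ)
      ≡⟨ cong (s k ℚ.* s k ℚ.+_) (trans (ℚ.*-assoc ε c⁻¹ (B ℚ.+ B ℚ.+ 1ℚ)) (trans (cong (ε ℚ.*_) eq) (ℚ.*-identityʳ ε))) ⟩
    s k ℚ.* s k ℚ.+ ε ∎
    where
    r = sqrtNum a k
    0≤u : 0ℚ ℚ.≤ u k
    0≤u = /-mono-≤ {0} {0} {1} {k} z≤n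
    u≤1 : u k ℚ.≤ 1ℚ
    u≤1 = /-mono-≤ {1} {k} {1} {0} (s≤s z≤n)
    0≤c : 0ℚ ℚ.≤ B ℚ.+ B ℚ.+ 1ℚ
    0≤c = ℚ.<⇒≤ (ℚ.+-mono-<-≤ (ℚ.+-mono-< B>0 B>0) (ℚ.nonNegative⁻¹ 1ℚ))
    s≤ : s k ℚ.≤ B
    s≤ = subst (ℚ._≤ B) (ℚ.0≤p⇒∣p∣≡p (/-mono-≤ {0} {0} {r} {k} z≤n)) s≤B

α₁ : ℝ
α₁ = fromℚ ½ *ℝ (fromℕ 1 -ℝ 1/ℝ (√ 3) (√≄0 2))

{-# OPTIONS --safe #-}

-- Let uv be an edge, x = n(u,v), y = n(v,u) and c = √3/18. Then x + y ≤ n, and since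
-- G is bipartite x ≥ d(u) and y ≥ d(v). AM-GM gives x y |x − y| ≤ c (x + y)³, hence
--   |x − y| ≤ c n² (x + y) / (x y) = c n² (1/x + 1/y) ≤ c n² (1/d(u) + 1/d(v)).
-- Summed over all edges, 1/d(u) + 1/d(v) counts every non-isolated vertex once, so
-- Mo(G) ≤ c n³. To stay in ℕ, √3 is replaced by fractions p/q ≥ √3 and 1/d(u) by n!/d(u).

module Submission where

open import Defs
open import Data.Bool.Base using (Bool; true; false; if_then_else_)
open import Data.Fin.Base using (Fin; zero; suc)
import Data.Fin.Properties as Fin
import Data.Integer.Base as ℤ
import Data.Integer.Properties as ℤ
open import Data.List.Base using (List; []; _∷_; _++_; map; filter; length; allFin; cartesianProduct)
open import Data.List.Properties using (map-++; map-∘; map-tabulate; length-filter; length-tabulate)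
open import Data.Nat.Base using (ℕ; zero; suc; _^_)
import Data.Nat.Base as ℕ
open import Data.Nat.Divisibility using (_∣_; ∣-trans; m∣m*n; m≤n⇒m!∣n!; quotient)
open import Data.Nat.ListAction using (sum)
open import Data.Nat.ListAction.Properties using (sum-++)
import Data.Nat.Properties as ℕ
open import Data.Nat.Solver using () renaming (module +-*-Solver to ℕ-Solver)
open import Data.Product.Base using (_×_; _,_; proj₂; ∃-syntax)
open import Data.Rational.Base using (_/_)
open import Data.Rational.Solver using () renaming (module +-*-Solver to ℚ-Solver)
import Data.Rational.Unnormalised.Base as ℚᵘ
import Data.Rational.Unnormalised.Properties as ℚᵘ
open import Data.Sum.Base using (inj₁; inj₂)
open import Data.Unit.Base using (tt)
open import Function.Base using (_∘_)
open import Level using (Level)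
import Relation.Binary.Construct.Add.Supremum.Strict as Supremum
open import Relation.Binary.PropositionalEquality
open import Relation.Nullary using (Dec; does; yes; no; ¬_; contradiction)
open import Relation.Nullary.Construct.Add.Supremum using (⊤⁺; [_])
open import Relation.Nullary.Decidable using (_×-dec_)
open import Relation.Unary using (Decidable)

module Counting where
  open import Data.Nat.Base
  open import Data.Nat.Properties

  -- The AM-GM inequality for a single edge, over ℕ.

  sq-cancel-≤ : ∀ {a b} → a * a ≤ b * b → a ≤ b
  sq-cancel-≤ h = ≮⇒≥ λ b<a → ≤⇒≯ h (sq-mono-< b<a)

  m≡n+o⇒n≤m : ∀ {m n} o → m ≡ n + o → n ≤ m
  m≡n+o⇒n≤m {n = n} o refl = m≤m+n n o

  -- Writing the larger of `x` and `y` as the smaller plus `e` makes the difference of the two sides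
  -- a polynomial with nonnegative coefficients: `9xe² + 8e³` if `x ≤ y`, and `9ye² + e³` if
  -- `y ≤ x`.
  am-gm : ∀ x y → 27 * (x * (y * y)) ≤ (x + (y + y)) * ((x + (y + y)) * (x + (y + y)))
  am-gm x y with ≤-total x y
  ... | inj₁ x≤y with e , refl ← m≤n⇒∃[o]m+o≡n x≤y = m≡n+o⇒n≤m (9 * (x * (e * e)) + 8 * (e * (e * e)))
    (solve 2 (λ x e → let y = x :+ e; s = x :+ (y :+ y) in
       s :* (s :* s) := con 27 :* (x :* (y :* y)) :+ (con 9 :* (x :* (e :* e)) :+ con 8 :* (e :* (e :* e)))) refl x e)
    where open ℕ-Solver
  ... | inj₂ y≤x with e , refl ← m≤n⇒∃[o]m+o≡n y≤x = m≡n+o⇒n≤m (9 * (y * (e * e)) + e * (e * e))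
    (solve 2 (λ y e → let x = y :+ e; s = x :+ (y :+ y) in
       s :* (s :* s) := con 27 :* (x :* (y :* y)) :+ (con 9 :* (y :* (e :* e)) :+ e :* (e :* e))) refl y e)
    where open ℕ-Solver

  -- The term 4mn is split into two equal summands so that the right-hand side has the shape
  -- `x + (y + y)` required by `am-gm`.
  [m+n]²≡∣m-n∣²+4mn : ∀ m n → (m + n) * (m + n) ≡ ∣ m - n ∣ * ∣ m - n ∣ + (2 * (m * n) + 2 * (m * n))
  [m+n]²≡∣m-n∣²+4mn m n with ≤-total m n
  ... | inj₁ m≤n with e , refl ← m≤n⇒∃[o]m+o≡n m≤n rewrite ∣m-m+n∣≡n m e =
    solve 2 (λ m e → let n = m :+ e; p = con 2 :* (m :* n) in (m :+ n) :* (m :+ n) := e :* e :+ (p :+ p)) refl m e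
    where open ℕ-Solver
  ... | inj₂ n≤m with e , refl ← m≤n⇒∃[o]m+o≡n n≤m rewrite trans (∣-∣-comm (n + e) n) (∣m-m+n∣≡n n e) =
    solve 2 (λ n e → let m = n :+ e; p = con 2 :* (m :* n) in (m :+ n) :* (m :+ n) := e :* e :+ (p :+ p)) refl n e
    where open ℕ-Solver

  -- 108 (x y (x − y))² ≤ (x + y)⁶ is AM-GM for (x − y)², 2 x y, 2 x y.
  edge-bound : ∀ {p q} → 3 * (q * q) ≤ p * p → ∀ x y →
               18 * q * (x * y * ∣ x - y ∣) ≤ p * ((x + y) * ((x + y) * (x + y)))
  edge-bound {p} {q} 3q²≤p² x y = sq-cancel-≤ (begin
    18 * q * (P * d) * (18 * q * (P * d))
      ≡⟨ solve 3 (λ q P d → con 18 :* q :* (P :* d) :* (con 18 :* q :* (P :* d))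
           := con 3 :* (q :* q) :* (con 27 :* (d :* d :* (con 2 :* P :* (con 2 :* P))))) refl q P d ⟩
    3 * (q * q) * (27 * (d * d * (2 * P * (2 * P))))
      ≤⟨ *-mono-≤ 3q²≤p² (am-gm (d * d) (2 * P)) ⟩
    p * p * (t * (t * t))
      ≡⟨ cong (λ z → p * p * (z * (z * z))) (sym ([m+n]²≡∣m-n∣²+4mn x y)) ⟩
    p * p * (S * S * (S * S * (S * S)))
      ≡⟨ solve 2 (λ p S → p :* p :* (S :* S :* (S :* S :* (S :* S))) := p :* (S :* (S :* S)) :* (p :* (S :* (S :* S)))) refl p S ⟩
    p * (S * (S * S)) * (p * (S * (S * S))) ∎)
    where
    open ≤-Reasoning
    open ℕ-Solver
    P = x * y
    d = ∣ x - y ∣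
    S = x + y
    t = d * d + (2 * P + 2 * P)

  -- Finite sums and indicators.

  private variable
    a p q r : Level
    A B : Set a
    P : A → Set p

  ∑ : List A → (A → ℕ) → ℕ
  ∑ xs f = sum (map f xs)

  𝟙 : {P : Set p} → Dec P → ℕ
  𝟙 P? = if does P? then 1 else 0

  𝟙-yes : {P : Set p} (P? : Dec P) → P → 𝟙 P? ≡ 1
  𝟙-yes (yes _) _ = refl
  𝟙-yes (no ¬p) p = contradiction p ¬p

  𝟙-disjoint : {P : Set p} {Q : Set q} {R : Set r} (P? : Dec P) (Q? : Dec Q) (R? : Dec R) →
               (P → R) → (Q → R) → (P → ¬ Q) → 𝟙 P? + 𝟙 Q? ≤ 𝟙 R?
  𝟙-disjoint (yes p) (yes q) _  _ _ ¬q = contradiction q (¬q p)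
  𝟙-disjoint (yes p) (no _)  R? f _ _ = ≤-reflexive (sym (𝟙-yes R? (f p)))
  𝟙-disjoint (no _)  (yes q) R? _ g _ = ≤-reflexive (sym (𝟙-yes R? (g q)))
  𝟙-disjoint (no _)  (no _)  _  _ _ _ = z≤n

  -- Extends an estimate known only for edges to all ordered pairs: off the edges both sides vanish.
  -- Sums over edges can then be compared term by term.
  𝟙-*-≤ : {P : Set p} (P? : Dec P) → ∀ a b c d → (P → a * b ≤ c * d) → a * (𝟙 P? * b) ≤ c * (𝟙 P? * d)
  𝟙-*-≤ (yes p) a b c d h rewrite +-identityʳ b | +-identityʳ d = h p
  𝟙-*-≤ (no _)  a b c d _ = ≤-trans (≤-reflexive (*-zeroʳ a)) z≤n

  ∑-mono : ∀ (xs : List A) {f g} → (∀ x → f x ≤ g x) → ∑ xs f ≤ ∑ xs g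
  ∑-mono []       f≤g = z≤n
  ∑-mono (x ∷ xs) f≤g = +-mono-≤ (f≤g x) (∑-mono xs f≤g)

  ∑-cong : ∀ (xs : List A) {f g} → (∀ x → f x ≡ g x) → ∑ xs f ≡ ∑ xs g
  ∑-cong []       f≡g = refl
  ∑-cong (x ∷ xs) f≡g = cong₂ _+_ (f≡g x) (∑-cong xs f≡g)

  ∑-distrib-+ : ∀ (xs : List A) f g → ∑ xs (λ x → f x + g x) ≡ ∑ xs f + ∑ xs g
  ∑-distrib-+ []       f g = refl
  ∑-distrib-+ (x ∷ xs) f g rewrite ∑-distrib-+ xs f g =
    solve 4 (λ a b c d → a :+ b :+ (c :+ d) := a :+ c :+ (b :+ d)) refl (f x) (g x) (∑ xs f) (∑ xs g)
    where open ℕ-Solver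

  ∑-distribˡ-* : ∀ (xs : List A) c f → ∑ xs (λ x → c * f x) ≡ c * ∑ xs f
  ∑-distribˡ-* []       c f = sym (*-zeroʳ c)
  ∑-distribˡ-* (x ∷ xs) c f rewrite ∑-distribˡ-* xs c f = sym (*-distribˡ-+ c (f x) (∑ xs f))

  ∑-const : ∀ (xs : List A) c → ∑ xs (λ _ → c) ≡ length xs * c
  ∑-const []       c = refl
  ∑-const (x ∷ xs) c = cong (c +_) (∑-const xs c)

  ∑-swap : ∀ (xs : List A) (ys : List B) (f : A → B → ℕ) → ∑ xs (λ x → ∑ ys (f x)) ≡ ∑ ys (λ y → ∑ xs (λ x → f x y))
  ∑-swap []       ys f = sym (trans (∑-const ys 0) (*-zeroʳ (length ys)))
  ∑-swap (x ∷ xs) ys f = trans (cong (∑ ys (f x) +_) (∑-swap xs ys f)) (sym (∑-distrib-+ ys (f x) (λ y → ∑ xs (λ x → f x y))))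

  ∑-filter : ∀ (P? : Decidable P) xs f → ∑ (filter P? xs) f ≡ ∑ xs (λ x → 𝟙 (P? x) * f x)
  ∑-filter P? []       f = refl
  ∑-filter P? (x ∷ xs) f with does (P? x)
  ... | true  = cong₂ _+_ (sym (+-identityʳ (f x))) (∑-filter P? xs f)
  ... | false = ∑-filter P? xs f

  length-filter-∑ : ∀ (P? : Decidable P) xs → length (filter P? xs) ≡ ∑ xs (λ x → 𝟙 (P? x))
  length-filter-∑ P? []       = refl
  length-filter-∑ P? (x ∷ xs) with does (P? x)
  ... | true  = cong suc (length-filter-∑ P? xs)
  ... | false = length-filter-∑ P? xs

  ∑-cartesianProduct : ∀ (xs : List A) (ys : List B) f →
                       ∑ (cartesianProduct xs ys) f ≡ ∑ xs (λ x → ∑ ys (λ y → f (x , y)))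
  ∑-cartesianProduct []       ys f = refl
  ∑-cartesianProduct (x ∷ xs) ys f = begin
    sum (map f (map (x ,_) ys ++ cartesianProduct xs ys))
      ≡⟨ cong sum (map-++ f (map (x ,_) ys) _) ⟩
    sum (map f (map (x ,_) ys) ++ map f (cartesianProduct xs ys))
      ≡⟨ sum-++ (map f (map (x ,_) ys)) _ ⟩
    sum (map f (map (x ,_) ys)) + ∑ (cartesianProduct xs ys) f
      ≡⟨ cong₂ _+_ (cong sum (sym (map-∘ ys))) (∑-cartesianProduct xs ys f) ⟩
    ∑ ys (λ y → f (x , y)) + ∑ xs (λ x → ∑ ys (λ y → f (x , y))) ∎
    where open ≡-Reasoning

  ∑-allFin-suc : ∀ n f → ∑ (allFin (suc n)) f ≡ f zero + ∑ (allFin n) (f ∘ suc)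
  ∑-allFin-suc n f = cong (λ z → f zero + sum z)
    (trans (map-tabulate suc f) (sym (map-tabulate (λ i → i) (f ∘ suc))))

  -- Makes it possible to add one vertex to a count as a further indicator under the same sum.
  ∑-𝟙-≟ : ∀ {n} (u : Fin n) → ∑ (allFin n) (λ w → 𝟙 (w Fin.≟ u)) ≡ 1
  ∑-𝟙-≟ {suc n} zero    = trans (∑-allFin-suc n (λ w → 𝟙 (w Fin.≟ zero))) (cong suc (trans (∑-const (allFin n) 0) (*-zeroʳ (length (allFin n)))))
  ∑-𝟙-≟ {suc n} (suc u) = trans (∑-allFin-suc n (λ w → 𝟙 (w Fin.≟ suc u))) (∑-𝟙-≟ u)

  -- Since `m` divides `m !`, which divides `n !`, the number `n !` serves as a common denominator
  -- for the reciprocals of all positive degrees.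
  ∣! : ∀ {m n} .{{_ : NonZero m}} → m ≤ n → m ∣ n !
  ∣! {suc m} m≤n = ∣-trans (m∣m*n (m !)) (m≤n⇒m!∣n! m≤n)

  -- Distances, degrees and double counting of edges.

  module _ {n : ℕ} (G : Graph n) where
    open Graph G

    degree : Fin n → ℕ
    degree u = length (filter (u ~?_) (allFin n))

    degree≤n : ∀ u → degree u ≤ n
    degree≤n u = subst (degree u ≤_) (length-tabulate (λ i → i)) (length-filter (u ~?_) (allFin n))

    -- The walk bounds the first distance by `k`, and `far` applied to a shortest walk puts the
    -- second above `k`. If no walk to `v` exists, the second distance is `⊤⁺`, above every finite
    -- one. Distances can thus be compared without being computed.
    dist-< : ∀ {w u v k} → Walk G w u k → (∀ l → Walk G w v l → k < l) → dist G w u <∞ dist G w v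
    dist-< {w} {u} {v} {k} p far with dist G w u | dist-correct G w u | dist G w v | dist-correct G w v
    ... | ⊤⁺    | none      | _     | _     = contradiction p (none k)
    ... | [ a ] | _ , a≤    | ⊤⁺    | _     = Supremum.[ a ]<⊤⁺
    ... | [ a ] | _ , a≤    | [ b ] | q , _ = Supremum.[ ≤-<-trans (a≤ k p) (far b q) ]

    closer-+ : ∀ u v → closer G u v + closer G v u ≤ n
    closer-+ u v = begin
      closer G u v + closer G v u
        ≡⟨ cong₂ _+_ (length-filter-∑ (λ w → dist G w u <∞? dist G w v) (allFin n))
                     (length-filter-∑ (λ w → dist G w v <∞? dist G w u) (allFin n)) ⟩
      ∑ (allFin n) _ + ∑ (allFin n) _  ≡⟨ sym (∑-distrib-+ (allFin n) _ _) ⟩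
      ∑ (allFin n) _                   ≤⟨ ∑-mono (allFin n) disjoint ⟩
      ∑ (allFin n) (λ _ → 1)           ≡⟨ ∑-const (allFin n) 1 ⟩
      length (allFin n) * 1            ≡⟨ *-identityʳ _ ⟩
      length (allFin n)                ≡⟨ length-tabulate (λ i → i) ⟩
      n                                ∎
      where
      open ≤-Reasoning
      disjoint : ∀ w → 𝟙 (dist G w u <∞? dist G w v) + 𝟙 (dist G w v <∞? dist G w u) ≤ 1
      -- The containing event is the trivially true one, whose indicator is 1.
      disjoint w = 𝟙-disjoint (dist G w u <∞? dist G w v) (dist G w v <∞? dist G w u) (yes tt) _ _
                              (Supremum.<⁺-asym _<_ <-asym)

    -- The vertices closer to u than to v include u and, by bipartiteness, its neighbours other than v.
    degree≤closer : Bipartite G → ∀ {u v} → u ~ v → degree u ≤ closer G u v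
    degree≤closer (side , proper) {u} {v} u~v = +-cancelʳ-≤ 1 _ _ (begin
      -- To avoid subtraction, the 1 on the left stands for `u`, which is not its own neighbour, and
      -- the 1 on the right pays for `v`, a neighbour of `u` that is not closer to `u`.
      degree u + 1
        ≡⟨ cong₂ _+_ (length-filter-∑ (u ~?_) (allFin n)) (sym (∑-𝟙-≟ u)) ⟩
      ∑ (allFin n) _ + ∑ (allFin n) _
        ≡⟨ sym (∑-distrib-+ (allFin n) _ _) ⟩
      ∑ (allFin n) (λ w → 𝟙 (u ~? w) + 𝟙 (w Fin.≟ u))
        ≤⟨ ∑-mono (allFin n) pointwise ⟩
      ∑ (allFin n) (λ w → 𝟙 (dist G w u <∞? dist G w v) + 𝟙 (w Fin.≟ v))
        ≡⟨ ∑-distrib-+ (allFin n) _ _ ⟩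
      ∑ (allFin n) _ + ∑ (allFin n) _
        ≡⟨ cong₂ _+_ (sym (length-filter-∑ (λ w → dist G w u <∞? dist G w v) (allFin n))) (∑-𝟙-≟ v) ⟩
      closer G u v + 1 ∎)
      where
      open ≤-Reasoning

      two-colours : (x y z : Bool) → x ≢ y → y ≢ z → x ≡ z
      two-colours false false _     x≢y _   = contradiction refl x≢y
      two-colours false true  false _   _   = refl
      two-colours false true  true  _   y≢z = contradiction refl y≢z
      two-colours true  true  _     x≢y _   = contradiction refl x≢y
      two-colours true  false true  _   _   = refl
      two-colours true  false false _   y≢z = contradiction refl y≢z

      closer-self : dist G u u <∞ dist G u v
      closer-self = dist-< [] λ { zero [] → contradiction u~v ~-irr ; (suc _) _ → s≤s z≤n }

      -- The distance from `w` to `u` is at most 1. A walk from `w` to `v` cannot have length 0 as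
      -- `w ≢ v`, nor length 1: both `w` and `v` differ in colour from `u`, so they share a colour
      -- and are not adjacent.
      closer-neighbour : ∀ {w} → u ~ w → w ≢ v → dist G w u <∞ dist G w v
      closer-neighbour {w} u~w w≢v = dist-< (~-sym u~w ∷ []) λ
        { zero [] → contradiction refl w≢v
        ; (suc zero) (w~v ∷ []) → contradiction
            (two-colours (side w) (side u) (side v) (proper w u (~-sym u~w)) (proper u v u~v))
            (proper w v w~v)
        ; (suc (suc _)) _ → s≤s (s≤s z≤n) }

      pointwise : ∀ w → 𝟙 (u ~? w) + 𝟙 (w Fin.≟ u) ≤ 𝟙 (dist G w u <∞? dist G w v) + 𝟙 (w Fin.≟ v)
      pointwise w with u ~? w | w Fin.≟ u
      ... | yes u~u | yes refl = contradiction u~u ~-irr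
      ... | no _    | no _     = z≤n
      ... | no _    | yes refl rewrite 𝟙-yes (dist G w u <∞? dist G w v) closer-self = s≤s z≤n
      ... | yes u~w | no _     with w Fin.≟ v
      ...   | yes _   = m≤n+m 1 _
      ...   | no w≢v  rewrite 𝟙-yes (dist G w u <∞? dist G w v) (closer-neighbour u~w w≢v) = ≤-refl

    degree>0 : ∀ {u v} → u ~ v → 0 < degree u
    degree>0 {u} {v} u~v = begin
      1                                    ≡⟨ sym (∑-𝟙-≟ v) ⟩
      ∑ (allFin n) (λ w → 𝟙 (w Fin.≟ v))   ≤⟨ ∑-mono (allFin n) pointwise ⟩
      ∑ (allFin n) (λ w → 𝟙 (u ~? w))      ≡⟨ sym (length-filter-∑ (u ~?_) (allFin n)) ⟩
      degree u                             ∎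
      where
      open ≤-Reasoning
      pointwise : ∀ w → 𝟙 (w Fin.≟ v) ≤ 𝟙 (u ~? w)
      pointwise w with w Fin.≟ v
      ... | no _     = z≤n
      ... | yes refl rewrite 𝟙-yes (u ~? w) u~v = ≤-refl

    -- Double counting: `w u` is collected once for every edge at `u`, whether `u` is its smaller or
    -- its larger endpoint.
    ∑-edges-+ : ∀ (w : Fin n → ℕ) → ∑ (edges G) (λ (u , v) → w u + w v) ≤ ∑ (allFin n) (λ u → w u * degree u)
    ∑-edges-+ w = begin
      ∑ (edges G) (λ (u , v) → w u + w v)
        ≡⟨ ∑-filter E? (cartesianProduct V V) _ ⟩
      ∑ (cartesianProduct V V) (λ (u , v) → 𝟙 (E? (u , v)) * (w u + w v))
        ≡⟨ ∑-cartesianProduct V V _ ⟩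
      ∑ V (λ u → ∑ V (λ v → 𝟙 (E? (u , v)) * (w u + w v)))
        ≡⟨ ∑-cong V (λ u → trans (∑-cong V (λ v → *-distribˡ-+ (𝟙 (E? (u , v))) (w u) (w v))) (∑-distrib-+ V _ _)) ⟩
      ∑ V (λ u → ∑ V (λ v → 𝟙 (E? (u , v)) * w u) + ∑ V (λ v → 𝟙 (E? (u , v)) * w v))
        ≡⟨ ∑-distrib-+ V _ _ ⟩
      ∑ V (λ u → ∑ V (λ v → 𝟙 (E? (u , v)) * w u)) + ∑ V (λ u → ∑ V (λ v → 𝟙 (E? (u , v)) * w v))
        -- After the swap `u` names the larger endpoint in the second sum, so both sums are indexed
        -- by the vertex whose weight is collected.
        ≡⟨ cong (∑ V (λ u → ∑ V (λ v → 𝟙 (E? (u , v)) * w u)) +_) (∑-swap V V _) ⟩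
      ∑ V (λ u → ∑ V (λ v → 𝟙 (E? (u , v)) * w u)) + ∑ V (λ u → ∑ V (λ v → 𝟙 (E? (v , u)) * w u))
        ≡⟨ sym (∑-distrib-+ V _ _) ⟩
      ∑ V (λ u → ∑ V (λ v → 𝟙 (E? (u , v)) * w u) + ∑ V (λ v → 𝟙 (E? (v , u)) * w u))
        ≡⟨ ∑-cong V (λ u → sym (∑-distrib-+ V _ _)) ⟩
      ∑ V (λ u → ∑ V (λ v → 𝟙 (E? (u , v)) * w u + 𝟙 (E? (v , u)) * w u))
        ≤⟨ ∑-mono V (λ u → ∑-mono V (λ v → pointwise u v)) ⟩
      ∑ V (λ u → ∑ V (λ v → w u * 𝟙 (u ~? v)))
        ≡⟨ ∑-cong V (λ u → trans (∑-distribˡ-* V (w u) _) (cong (w u *_) (sym (length-filter-∑ (u ~?_) V)))) ⟩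
      ∑ V (λ u → w u * degree u) ∎
      where
      open ≤-Reasoning
      V = allFin n
      E? = λ ((u , v) : Fin n × Fin n) → (u Fin.<? v) ×-dec (u ~? v)

      once : ∀ u v → 𝟙 (E? (u , v)) + 𝟙 (E? (v , u)) ≤ 𝟙 (u ~? v)
      once u v = 𝟙-disjoint (E? (u , v)) (E? (v , u)) (u ~? v) proj₂ (λ (_ , v~u) → ~-sym v~u)
                            (λ (u<v , _) (v<u , _) → <-asym u<v v<u)

      pointwise : ∀ u v → 𝟙 (E? (u , v)) * w u + 𝟙 (E? (v , u)) * w u ≤ w u * 𝟙 (u ~? v)
      pointwise u v = begin
        𝟙 (E? (u , v)) * w u + 𝟙 (E? (v , u)) * w u  ≡⟨ sym (*-distribʳ-+ (w u) (𝟙 (E? (u , v))) _) ⟩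
        (𝟙 (E? (u , v)) + 𝟙 (E? (v , u))) * w u      ≤⟨ *-monoˡ-≤ (w u) (once u v) ⟩
        𝟙 (u ~? v) * w u                             ≡⟨ *-comm (𝟙 (u ~? v)) (w u) ⟩
        w u * 𝟙 (u ~? v)                             ∎

    -- n! / d(u), an integral multiple of 1 / d(u); it is 0 at isolated vertices.
    weight : Fin n → ℕ
    weight u with degree u | degree≤n u
    ... | zero  | _   = 0
    ... | suc d | d≤n = quotient (∣! d≤n)

    weight*degree : ∀ {u} → 0 < degree u → weight u * degree u ≡ n !
    weight*degree {u} d>0 with degree u | degree≤n u
    ... | suc d | d≤n = sym (_∣_.equality (∣! d≤n))

    -- At an isolated vertex the product is 0; elsewhere it is exactly `n !`. Summing over all
    -- vertices therefore gives at most `n * n !`.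
    weight*degree≤ : ∀ u → weight u * degree u ≤ n !
    weight*degree≤ u with degree u | degree≤n u
    ... | zero  | _   = z≤n
    ... | suc d | d≤n = ≤-reflexive (sym (_∣_.equality (∣! d≤n)))

    -- The weighted estimate for an edge and the integer bound on Mo(G).

    module _ (bip : Bipartite G) {p q : ℕ} (3q²≤p² : 3 * (q * q) ≤ p * p) where

      -- For `q > 0` this is |x - y| ≤ (p / 18q) n² (1/d(u) + 1/d(v)), multiplied by
      -- `n ! * (18 * q)` to clear denominators. It is proved after multiplication by `x * y`, which
      -- is positive because both endpoints have positive degree.
      edge-weight : ∀ {u v} → u ~ v →
        n ! * (18 * q) * ∣ closer G u v - closer G v u ∣ ≤ p * (n * n) * (weight u + weight v)
      edge-weight {u} {v} u~v = *-cancelʳ-≤ _ _ (x * y) {{m*n≢0 x y {{>-nonZero x>0}} {{>-nonZero y>0}}}} (begin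
        M * (18 * q) * d * (x * y)
          ≡⟨ solve 4 (λ M q d P → M :* (con 18 :* q) :* d :* P := M :* (con 18 :* q :* (P :* d))) refl M q d (x * y) ⟩
        M * (18 * q * (x * y * d))
          ≤⟨ *-monoʳ-≤ M (edge-bound {p} {q} 3q²≤p² x y) ⟩
        M * (p * ((x + y) * ((x + y) * (x + y))))
          -- Only two of the three factors `x + y` are bounded by `n`. The third yields `M * y` and
          -- `M * x`, which correspond to 1/x and 1/y once `x * y` is cancelled.
          ≤⟨ *-monoʳ-≤ M (*-monoʳ-≤ p (*-monoʳ-≤ (x + y) (*-mono-≤ (closer-+ u v) (closer-+ u v)))) ⟩
        M * (p * ((x + y) * (n * n)))
          ≡⟨ solve 5 (λ M p x y n → M :* (p :* ((x :+ y) :* (n :* n)))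
               := p :* (n :* n) :* (M :* y :+ M :* x)) refl M p x y n ⟩
        p * (n * n) * (M * y + M * x)
          ≤⟨ *-monoʳ-≤ (p * (n * n)) (+-mono-≤ (*-monoˡ-≤ y M≤x) (*-monoˡ-≤ x M≤y)) ⟩
        p * (n * n) * (weight u * x * y + weight v * y * x)
          ≡⟨ solve 5 (λ c a b x y → c :* (a :* x :* y :+ b :* y :* x) := c :* (a :+ b) :* (x :* y)) refl
               (p * (n * n)) (weight u) (weight v) x y ⟩
        p * (n * n) * (weight u + weight v) * (x * y) ∎)
        where
        open ≤-Reasoning
        open ℕ-Solver
        M = n !
        x = closer G u v
        y = closer G v u
        d = ∣ x - y ∣
        v~u = ~-sym u~v
        x>0 : 0 < x
        x>0 = <-≤-trans (degree>0 u~v) (degree≤closer bip u~v)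
        y>0 : 0 < y
        y>0 = <-≤-trans (degree>0 v~u) (degree≤closer bip v~u)
        M≤x : M ≤ weight u * x
        M≤x = subst (_≤ weight u * x) (weight*degree (degree>0 u~v)) (*-monoʳ-≤ (weight u) (degree≤closer bip u~v))
        M≤y : M ≤ weight v * y
        M≤y = subst (_≤ weight v * y) (weight*degree (degree>0 v~u)) (*-monoʳ-≤ (weight v) (degree≤closer bip v~u))

      Mo-bound : 18 * q * Mo G ≤ p * n ^ 3
      -- The factor `n !` is carried along to keep the weights integral; the sum over vertices
      -- returns it, and it is cancelled.
      Mo-bound = *-cancelˡ-≤ (n !) {{n !≢0}} (begin
        n ! * (18 * q * Mo G)
          ≡⟨ sym (*-assoc (n !) (18 * q) (Mo G)) ⟩
        n ! * (18 * q) * Mo G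
          ≡⟨ cong (n ! * (18 * q) *_) (∑-filter E? VV _) ⟩
        n ! * (18 * q) * ∑ VV (λ e → 𝟙 (E? e) * f e)
          ≡⟨ sym (∑-distribˡ-* VV (n ! * (18 * q)) _) ⟩
        ∑ VV (λ e → n ! * (18 * q) * (𝟙 (E? e) * f e))
          ≤⟨ ∑-mono VV pointwise ⟩
        ∑ VV (λ e → p * (n * n) * (𝟙 (E? e) * g e))
          ≡⟨ ∑-distribˡ-* VV (p * (n * n)) _ ⟩
        p * (n * n) * ∑ VV (λ e → 𝟙 (E? e) * g e)
          ≡⟨ cong (p * (n * n) *_) (sym (∑-filter E? VV g)) ⟩
        p * (n * n) * ∑ (edges G) g
          ≤⟨ *-monoʳ-≤ (p * (n * n)) (≤-trans (∑-edges-+ weight) (∑-mono V weight*degree≤)) ⟩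
        p * (n * n) * ∑ V (λ _ → n !)
          ≡⟨ cong (p * (n * n) *_) (trans (∑-const V (n !)) (cong (_* n !) (length-tabulate {n = n} (λ i → i)))) ⟩
        p * (n * n) * (n * n !)
          -- The trailing `con 1` matches the unfolding of `n ^ 3`.
          ≡⟨ solve 3 (λ p n M → p :* (n :* n) :* (n :* M) := M :* (p :* (n :* (n :* (n :* con 1))))) refl p n (n !) ⟩
        n ! * (p * n ^ 3) ∎)
        where
        open ≤-Reasoning
        open ℕ-Solver
        V = allFin n
        VV = cartesianProduct V V
        E? = λ ((u , v) : Fin n × Fin n) → (u Fin.<? v) ×-dec (u ~? v)
        f = λ ((u , v) : Fin n × Fin n) → ∣ closer G u v - closer G v u ∣
        g = λ ((u , v) : Fin n × Fin n) → weight u + weight v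

        pointwise : ∀ e → n ! * (18 * q) * (𝟙 (E? e) * f e) ≤ p * (n * n) * (𝟙 (E? e) * g e)
        pointwise e = 𝟙-*-≤ (E? e) (n ! * (18 * q)) (f e) (p * (n * n)) (g e) (λ (_ , u~v) → edge-weight u~v)

open import Data.Integer.Base using (+_)

-- Passage from rational approximations to the real constants.

module Reals where
  open import Data.Rational.Base hiding (_≃_; _/_)
  open import Data.Rational.Properties hiding (≃-sym)

  /-* : ∀ a b c d → (+ a / suc b) * (+ c / suc d) ≡ + (a ℕ.* c) / (suc b ℕ.* suc d)
  /-* a b c d = toℚᵘ-injective (ℚᵘ.≃-trans
    (toℚᵘ-homo-* (+ a / suc b) (+ c / suc d))
    (ℚᵘ.≃-trans (ℚᵘ.*-cong (toℚᵘ-/ a b) (toℚᵘ-/ c d))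
      (ℚᵘ.≃-trans (ℚᵘ.*≡* (cong (ℤ._* + (suc b ℕ.* suc d)) (sym (ℤ.pos-* a c))))
                  -- `d + b * suc d` is the predecessor of `suc b * suc d`.
                  (ℚᵘ.≃-sym (toℚᵘ-/ (a ℕ.* c) (d ℕ.+ b ℕ.* suc d))))))

  0≤/ : ∀ a d → 0ℚ ≤ + a / suc d
  0≤/ a d = /-mono-≤ {0} {0} {a} {d} ℕ.z≤n

  -- Takes `η = ε / (1 + c)`; dividing by `1 + c` instead of `c` covers `c = 0`.
  scale : ∀ {c ε} → 0ℚ ≤ c → 0ℚ < ε → ∃[ η ] (0ℚ < η × η * c ≤ ε)
  scale {c} {ε} 0≤c ε>0 with recip {1ℚ + c} (+-mono-<-≤ (positive⁻¹ 1ℚ) 0≤c)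
  ... | r , r>0 , r[1+c]≡1 = ε * r , η>0 , (begin
    ε * r * c           ≤⟨ *-monoˡ-≤-nonNeg (ε * r) {{nonNegative (<⇒≤ η>0)}} (subst (_≤ 1ℚ + c) (+-identityˡ c) (+-monoˡ-≤ c (nonNegative⁻¹ 1ℚ))) ⟩
    ε * r * (1ℚ + c)    ≡⟨ *-assoc ε r (1ℚ + c) ⟩
    ε * (r * (1ℚ + c))  ≡⟨ cong (ε *_) r[1+c]≡1 ⟩
    ε * 1ℚ              ≡⟨ *-identityʳ ε ⟩
    ε                   ∎)
    where
    open ≤-Reasoning
    η>0 = pos*pos ε>0 r>0

  ≃⇒≤ℝ : ∀ {x y} → x ≃ y → x ≤ℝ y
  ≃⇒≤ℝ {x} {y} x≃y ε ε>0 with x≃y ε ε>0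
  ... | N , close = N , λ k N≤k → begin
    seq x k                        ≡⟨ solve 2 (λ a b → a := b :+ (a :- b)) refl (seq x k) (seq y k) ⟩
    seq y k + (seq x k - seq y k)  ≤⟨ +-monoʳ-≤ (seq y k) (≤-trans (p≤∣p∣ (seq x k - seq y k)) (close k N≤k)) ⟩
    seq y k + ε                    ∎
    where
    open ≤-Reasoning
    open ℚ-Solver
    p≤∣p∣ : ∀ p → p ≤ ∣ p ∣
    p≤∣p∣ p with ≤-total 0ℚ p
    ... | inj₁ 0≤p = ≤-reflexive (sym (0≤p⇒∣p∣≡p 0≤p))
    ... | inj₂ p≤0 = ≤-trans p≤0 (0≤∣p∣ p)

  ≃-sym : ∀ {x y} → x ≃ y → y ≃ x
  ≃-sym {x} {y} x≃y ε ε>0 with x≃y ε ε>0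
  ... | N , close = N , λ k N≤k → subst (_≤ ε) (∣p-q∣≡∣q-p∣ (seq x k) (seq y k)) (close k N≤k)

  ≤ℝ-trans : ∀ {x y z} → x ≤ℝ y → y ≤ℝ z → x ≤ℝ z
  ≤ℝ-trans {x} {y} {z} x≤y y≤z ε ε>0 with x≤y (ε * ½) (half ε>0) | y≤z (ε * ½) (half ε>0)
  ... | N , p | M , q = N ℕ.⊔ M , λ k N≤k → begin
    seq x k                        ≤⟨ p k (ℕ.m⊔n≤o⇒m≤o N M N≤k) ⟩
    seq y k + ε * ½                ≤⟨ +-monoˡ-≤ (ε * ½) (q k (ℕ.m⊔n≤o⇒n≤o N M N≤k)) ⟩
    seq z k + ε * ½ + ε * ½        ≡⟨ +-assoc (seq z k) (ε * ½) (ε * ½) ⟩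
    seq z k + (ε * ½ + ε * ½)      ≡⟨ cong (_+_ (seq z k)) (half+half ε) ⟩
    seq z k + ε                    ∎
    where open ≤-Reasoning

  -- α(1 − α)(1 − 2α) at α = (1 − i)/2; with i ≈ 1/√3 this is the paper's constant.
  cubic : ℚ → ℚ
  cubic i = let α = ½ * (1ℚ - i) in α * (1ℚ - α) * (1ℚ - (+ 2 / 1) * α)

  -- A rational `s` never squares to 3, so the two constants differ at every approximation. The
  -- identity exhibits `s * s - 3` as a factor of the difference, and this factor tends to 0.
  cubic-identity : ∀ s i → s * i ≡ 1ℚ →
    cubic i - s * (+ 1 / 18) ≡ (s * s - (+ 3 / 1)) * (i * (i * i * (+ 1 / 12) - (+ 1 / 18)))
  cubic-identity s i si≡1 = begin
    cubic i - s * (+ 1 / 18)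
      ≡⟨ solve 2 (λ s i → let α = con ½ :* (con 1ℚ :- i) in
           α :* (con 1ℚ :- α) :* (con 1ℚ :- con (+ 2 / 1) :* α) :- s :* con (+ 1 / 18)
           := con (+ 1 / 12) :* i :* (con 1ℚ :* con 1ℚ) :- con (+ 1 / 18) :* s :* con 1ℚ
              :- con (+ 1 / 4) :* (i :* i :* i) :+ con (+ 1 / 6) :* i) refl s i ⟩
    -- Here `cubic i` is (i - i³)/4, with i/4 split as i/12 + i/6. Replacing the marked units by
    -- `s * i` turns i/12 and s/18 into s²i³/12 and s²i/18; the remaining i³/4 and i/6 are three
    -- times i³/12 and i/18, whence the factor s² - 3.
    (+ 1 / 12) * i * (1ℚ * 1ℚ) - (+ 1 / 18) * s * 1ℚ - (+ 1 / 4) * (i * i * i) + (+ 1 / 6) * i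
      ≡⟨ cong (λ z → (+ 1 / 12) * i * (z * z) - (+ 1 / 18) * s * z - (+ 1 / 4) * (i * i * i) + (+ 1 / 6) * i) (sym si≡1) ⟩
    (+ 1 / 12) * i * (s * i * (s * i)) - (+ 1 / 18) * s * (s * i) - (+ 1 / 4) * (i * i * i) + (+ 1 / 6) * i
      ≡⟨ solve 2 (λ s i → con (+ 1 / 12) :* i :* (s :* i :* (s :* i)) :- con (+ 1 / 18) :* s :* (s :* i)
              :- con (+ 1 / 4) :* (i :* i :* i) :+ con (+ 1 / 6) :* i
           := (s :* s :- con (+ 3 / 1)) :* (i :* (i :* i :* con (+ 1 / 12) :- con (+ 1 / 18)))) refl s i ⟩
    (s * s - (+ 3 / 1)) * (i * (i * i * (+ 1 / 12) - (+ 1 / 18))) ∎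
    where
    open ≡-Reasoning
    open ℚ-Solver

  cubic-factor-≤1 : ∀ i → ∣ i ∣ ≤ 1ℚ → ∣ i * (i * i * (+ 1 / 12) - (+ 1 / 18)) ∣ ≤ 1ℚ
  cubic-factor-≤1 i i≤1 = subst (_≤ 1ℚ) (sym (∣p*q∣≡∣p∣*∣q∣ i _)) (*-mono (0≤∣p∣ i) (nonNegative⁻¹ 1ℚ) i≤1 (begin
    ∣ i * i * (+ 1 / 12) - (+ 1 / 18) ∣         ≤⟨ ∣p+q∣≤∣p∣+∣q∣ (i * i * (+ 1 / 12)) (- (+ 1 / 18)) ⟩
    ∣ i * i * (+ 1 / 12) ∣ + (+ 1 / 18)         ≡⟨ cong (_+ (+ 1 / 18)) (trans (∣p*q∣≡∣p∣*∣q∣ (i * i) (+ 1 / 12)) (cong (_* (+ 1 / 12)) (∣p*q∣≡∣p∣*∣q∣ i i))) ⟩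
    ∣ i ∣ * ∣ i ∣ * (+ 1 / 12) + (+ 1 / 18)     ≤⟨ +-monoˡ-≤ (+ 1 / 18) (*-monoʳ-≤-nonNeg (+ 1 / 12) (*-mono (0≤∣p∣ i) (nonNegative⁻¹ 1ℚ) i≤1 i≤1)) ⟩
    -- The left-hand side is 5/36, and 36 = 5 + 31.
    1ℚ * 1ℚ * (+ 1 / 12) + (+ 1 / 18)           ≤⟨ *≤* (ℤ.+≤+ (ℕ.m≤m+n 5 31)) ⟩
    1ℚ                                          ∎))
    where open ≤-Reasoning

  cubic-close : ∀ s i c η ε → 0ℚ ≤ c → s * i ≡ 1ℚ → ∣ i ∣ ≤ 1ℚ → ∣ s * s - (+ 3 / 1) ∣ ≤ η → η * c ≤ ε →
                ∣ cubic i * c - s * (+ 1 / 18) * c ∣ ≤ ε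
  cubic-close s i c η ε 0≤c si≡1 i≤1 close ηc≤ε = begin
    ∣ cubic i * c - s * (+ 1 / 18) * c ∣
      ≡⟨ cong ∣_∣ (solve 3 (λ a b c → a :* c :- b :* c := (a :- b) :* c) refl (cubic i) (s * (+ 1 / 18)) c) ⟩
    ∣ (cubic i - s * (+ 1 / 18)) * c ∣
      ≡⟨ cong (λ z → ∣ z * c ∣) (cubic-identity s i si≡1) ⟩
    ∣ (s * s - (+ 3 / 1)) * F * c ∣
      ≡⟨ trans (∣p*q∣≡∣p∣*∣q∣ ((s * s - (+ 3 / 1)) * F) c) (cong₂ _*_ (∣p*q∣≡∣p∣*∣q∣ (s * s - (+ 3 / 1)) F) (0≤p⇒∣p∣≡p 0≤c)) ⟩
    ∣ s * s - (+ 3 / 1) ∣ * ∣ F ∣ * c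
      ≤⟨ *-monoʳ-≤-nonNeg c {{nonNegative 0≤c}} (*-mono (0≤∣p∣ (s * s - (+ 3 / 1))) (nonNegative⁻¹ 1ℚ) close (cubic-factor-≤1 i i≤1)) ⟩
    η * 1ℚ * c
      ≡⟨ cong (_* c) (*-identityʳ η) ⟩
    η * c
      ≤⟨ ηc≤ε ⟩
    ε ∎
    where
    open ≤-Reasoning
    open ℚ-Solver
    F = i * (i * i * (+ 1 / 12) - (+ 1 / 18))

  -- All real operations act termwise, so the k-th term on the left unfolds to `cubic` at the
  -- reciprocal of the k-th approximation of √3, times `m`. Hence `cubic-close` applies at each
  -- sufficiently large index.
  α₁-value : ∀ m → α₁ *ℝ (fromℕ 1 -ℝ α₁) *ℝ (fromℕ 1 -ℝ fromℕ 2 *ℝ α₁) *ℝ fromℕ m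
                 ≃ √ 3 *ℝ fromℚ (+ 1 / 18) *ℝ fromℕ m
  α₁-value m ε ε>0 =
    let η , η>0 , ηm≤ε = scale (0≤/ m 0) ε>0
        δ , δ>0 , N₁ , δ≤s = √≄0 2
        N₂ , close = √-square 3 η η>0
    in N₁ ℕ.⊔ N₂ , λ k N≤k →
      cubic-close (seq (√ 3) k) (inv (seq (√ 3) k)) (+ m / 1) η ε (0≤/ m 0)
        (inv-inverse (≄0⇒≢0 δ>0 (δ≤s k (ℕ.m⊔n≤o⇒m≤o N₁ N₂ N≤k))))
        -- The lower bound `δ` supplied by `√≄0` is 1, so its reciprocal is 1 and `refl` suffices.
        (∣inv∣≤ {p = seq (√ 3) k} δ>0 (positive⁻¹ 1ℚ) refl (δ≤s k (ℕ.m⊔n≤o⇒m≤o N₁ N₂ N≤k)))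
        (close k (ℕ.m⊔n≤o⇒n≤o N₁ N₂ N≤k))
        ηm≤ε

  -- The hypothesis bounds `a` using an approximation of √3 from above, which exceeds the k-th term
  -- of `√ 3` by exactly 1/(k + 1). The excess c/(k + 1), with c = b/18, falls below any `ε`.
  ≤√3/18 : ∀ {a b} → (∀ k → 18 ℕ.* suc k ℕ.* a ℕ.≤ suc (sqrtNum 3 k) ℕ.* b) →
           fromℕ a ≤ℝ √ 3 *ℝ fromℚ (+ 1 / 18) *ℝ fromℕ b
  ≤√3/18 {a} {b} h ε ε>0 =
    let η , η>0 , ηc≤ε = scale 0≤c ε>0
        N , small = archimedean η η>0
    in N , λ k N≤k → bound k (≤-trans (*-monoʳ-≤-nonNeg c {{nonNegative 0≤c}} (small k N≤k)) ηc≤ε)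
    where
    open ≤-Reasoning
    c = (+ 1 / 18) * (+ b / 1)
    0≤c : 0ℚ ≤ c
    0≤c = *-mono {0ℚ} {+ 1 / 18} {0ℚ} {+ b / 1} ≤-refl (0≤/ b 0) (nonNegative⁻¹ (+ 1 / 18)) (0≤/ b 0)

    -- The factors 1 reproduce the unreduced numerators and denominators that `/-*` yields.
    cross : ∀ k → a ℕ.* (suc k ℕ.* 18 ℕ.* 1) ℕ.≤ suc (sqrtNum 3 k) ℕ.* 1 ℕ.* b ℕ.* 1
    cross k = subst₂ ℕ._≤_
      (solve 2 (λ a k → con 18 :* k :* a := a :* (k :* con 18 :* con 1)) refl a (suc k))
      (solve 2 (λ r b → r :* b := r :* con 1 :* b :* con 1) refl (suc (sqrtNum 3 k)) b)
      (h k)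
      where open ℕ-Solver

    distribute : ∀ s u x y → (s + u) * x * y ≡ s * x * y + u * (x * y)
    distribute = solve 4 (λ s u x y → (s :+ u) :* x :* y := s :* x :* y :+ u :* (x :* y)) refl
      where open ℚ-Solver

    bound : ∀ k → (+ 1 / suc k) * c ≤ ε → + a / 1 ≤ seq (√ 3) k * (+ 1 / 18) * (+ b / 1) + ε
    bound k uc≤ε = begin
      + a / 1
        ≤⟨ /-mono-≤ {a} {0} {suc r ℕ.* 1 ℕ.* b} (cross k) ⟩
      + (suc r ℕ.* 1 ℕ.* b) / (suc k ℕ.* 18 ℕ.* 1)
        -- `17 + k * 18` is the predecessor of `suc k * 18`.
        ≡⟨ sym (/-* (suc r ℕ.* 1) (17 ℕ.+ k ℕ.* 18) b 0) ⟩
      (+ (suc r ℕ.* 1) / (suc k ℕ.* 18)) * (+ b / 1)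
        ≡⟨ cong (_* (+ b / 1)) (sym (/-* (suc r) k 1 17)) ⟩
      (+ suc r / suc k) * (+ 1 / 18) * (+ b / 1)
        ≡⟨ cong (λ z → z * (+ 1 / 18) * (+ b / 1)) (/-suc r k) ⟩
      (+ r / suc k + + 1 / suc k) * (+ 1 / 18) * (+ b / 1)
        ≡⟨ distribute (+ r / suc k) (+ 1 / suc k) (+ 1 / 18) (+ b / 1) ⟩
      (+ r / suc k) * (+ 1 / 18) * (+ b / 1) + (+ 1 / suc k) * c
        ≤⟨ +-monoʳ-≤ ((+ r / suc k) * (+ 1 / 18) * (+ b / 1)) uc≤ε ⟩
      (+ r / suc k) * (+ 1 / 18) * (+ b / 1) + ε ∎
      where r = sqrtNum 3 k

theorem1 : ∀ (n : ℕ) (G : Graph n) → Bipartite G →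
    (fromℕ (Mo G) ≤ℝ α₁ *ℝ (fromℕ 1 -ℝ α₁) *ℝ (fromℕ 1 -ℝ fromℕ 2 *ℝ α₁) *ℝ fromℕ (n ^ 3))
    × (α₁ *ℝ (fromℕ 1 -ℝ α₁) *ℝ (fromℕ 1 -ℝ fromℕ 2 *ℝ α₁) *ℝ fromℕ (n ^ 3) ≃ √ 3 *ℝ fromℚ (+ 1 / 18) *ℝ fromℕ (n ^ 3))
theorem1 n G bip = ≤ℝ-trans {fromℕ (Mo G)} {bound} {value} Mo≤ (≃⇒≤ℝ {bound} {value} (≃-sym {value} {bound} eq)) , eq
  where
  open Counting
  open Reals
  value bound : ℝ
  value = α₁ *ℝ (fromℕ 1 -ℝ α₁) *ℝ (fromℕ 1 -ℝ fromℕ 2 *ℝ α₁) *ℝ fromℕ (n ^ 3)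
  bound = √ 3 *ℝ fromℚ (+ 1 / 18) *ℝ fromℕ (n ^ 3)
  eq : value ≃ bound
  eq = α₁-value (n ^ 3)
  Mo≤ : fromℕ (Mo G) ≤ℝ bound
  -- With `p = suc (sqrtNum 3 k)` and `q = suc k`, the maximality of the integer square root gives
  -- 3q² < p², so p/q is an upper approximation of √3.
  Mo≤ = ≤√3/18 {Mo G} {n ^ 3} λ k → Mo-bound G bip {suc (sqrtNum 3 k)} {suc k} (ℕ.<⇒≤ (isqrt-upper (3 ℕ.* (suc k ℕ.* suc k))))
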